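{- Let $n\geq 4$ be a positive integer. Then: (1) $t(n,3,n-2)=n$; (2) $t(n,3,n-1)=n-1$.
   Context: All graphs are finite, undirected and simple. Let $G$ be a nontrivial connected graph of order $n$ (i.e. with $n$ vertices). An edge-coloring of $G$ is any assignment of colors to the edges (adjacent edges may receive the same color). A tree $T$ that is a subgraph of $G$ is a rainbow tree if no two edges of $T$ have the same color. For $S\subseteq V(G)$ with $|S|\geq 2$, a rainbow $S$-tree is a rainbow tree $T$ in $G$ with $S\subseteq V(T)$. For an integer $k$ with $2\leq k\leq n$, an edge-coloring of $G$ is a $k$-rainbow coloring if for every $k$-subset $S$ of $V(G)$ there exists a rainbow $S$-tree. The $k$-rainbow index $rx_k(G)$ is the minimum number of colors needed in a $k$-rainbow coloring of $G$. For integers $2\leq k\leq n$ and $2\leq\ell\leq n-1$, $t(n,k,\ell)$ denotes the minimum size (number of edges) of a connected graph $G$ of order $n$ with $rx_k(G)\leq \ell$ (when such a graph exists). -}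

module Defs where

open import Data.Bool.Base using (Bool; T)
open import Data.Bool.Properties using (T?)
open import Data.Fin.Base using (Fin)
open import Data.Fin.Properties using (_<?_)
open import Data.Fin.Subset using (Subset; _∈_; _⊆_; ∣_∣)
open import Data.List.Base using (List; []; _∷_; _++_; length; filter; allFin; cartesianProduct)
open import Data.List.Relation.Unary.Linked using (Linked)
open import Data.List.Relation.Unary.Unique.Propositional using (Unique)
open import Data.Nat.Base using (ℕ; _≤_)
open import Data.Product.Base using (_×_; _,_; Σ-syntax; ∃-syntax)
open import Data.Sum.Base using (_⊎_)
open import Relation.Binary.Construct.Closure.ReflexiveTransitive using (Star)
open import Relation.Binary.PropositionalEquality using (_≡_)
open import Relation.Nullary.Decidable using (_×-dec_)
open import Relation.Nullary.Negation using (¬_)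

private variable
  n : ℕ

IsLeast : (ℕ → Set) → ℕ → Set
IsLeast P m = P m × (∀ j → P j → m ≤ j)

-- Finite simple graphs of order n, on the vertex set Fin n.
record Graph (n : ℕ) : Set where
  field
    adj : Fin n → Fin n → Bool

  Adj : Fin n → Fin n → Set
  Adj u v = T (adj u v)

  field
    sym    : ∀ u v → Adj u v → Adj v u
    irrefl : ∀ u → ¬ Adj u u

open Graph public using (Adj)

-- Each edge {u, v} is counted once, as the pair with u < v.
size : Graph n → ℕ
size {n} G =
  length (filter (λ (u , v) → (u <? v) ×-dec T? (Graph.adj G u v))
                 (cartesianProduct (allFin n) (allFin n)))

Connected : Graph n → Set
Connected G = ∀ u v → Star (Adj G) u v

record Subgraph (G : Graph n) : Set where
  field
    vertices : Subset n
    edge     : Fin n → Fin n → Bool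

  Edge : Fin n → Fin n → Set
  Edge u v = T (edge u v)

  field
    edge-sym : ∀ u v → Edge u v → Edge v u
    edge⇒adj : ∀ u v → Edge u v → Adj G u v
    edge⇒∈   : ∀ u v → Edge u v → u ∈ vertices

open Subgraph public using (vertices; Edge)

-- v₀ ∷ vs lists the distinct vertices, at least three of them, of a cycle
-- in the order in which they are visited.
IsCycle : (Fin n → Fin n → Set) → Fin n → List (Fin n) → Set
IsCycle E v₀ vs = 2 ≤ length vs × Unique (v₀ ∷ vs) × Linked E (v₀ ∷ vs ++ v₀ ∷ [])

-- A subgraph without vertices also satisfies IsTree; it contains no
-- nonempty S, so this does not affect rainbow S-trees.
record IsTree {G : Graph n} (H : Subgraph G) : Set where
  field
    connected : ∀ u v → u ∈ vertices H → v ∈ vertices H → Star (Edge H) u v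
    acyclic   : ∀ v₀ vs → ¬ IsCycle (Edge H) v₀ vs

-- Edge-colorings with colors from a palette of c colors, not all of which
-- need occur; colors are assigned to unordered edges, hence color-sym.
record EdgeColoring (G : Graph n) (c : ℕ) : Set where
  field
    color     : ∀ u v → Adj G u v → Fin c
    color-sym : ∀ u v (p : Adj G u v) (q : Adj G v u) → color u v p ≡ color v u q

IsRainbow : {G : Graph n} {c : ℕ} → EdgeColoring G c → Subgraph G → Set
IsRainbow χ H =
  ∀ u v x y (e : Edge H u v) (f : Edge H x y) →
  color u v (edge⇒adj u v e) ≡ color x y (edge⇒adj x y f) →
  (u ≡ x × v ≡ y) ⊎ (u ≡ y × v ≡ x)
  where
  open EdgeColoring χ
  open Subgraph H using (edge⇒adj)

RainbowSTree : {G : Graph n} {c : ℕ} → EdgeColoring G c → Subset n → Set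
RainbowSTree {G = G} χ S =
  Σ[ H ∈ Subgraph G ] IsTree H × IsRainbow χ H × S ⊆ vertices H

IsRainbowColoring : ℕ → {G : Graph n} {c : ℕ} → EdgeColoring G c → Set
IsRainbowColoring {n} k χ = (S : Subset n) → ∣ S ∣ ≡ k → RainbowSTree χ S

rx[_]_≡_ : ℕ → Graph n → ℕ → Set
rx[ k ] G ≡ r = IsLeast (λ c → Σ[ χ ∈ EdgeColoring G c ] IsRainbowColoring k χ) r

rx[_]_≤_ : ℕ → Graph n → ℕ → Set
rx[ k ] G ≤ ℓ = ∃[ r ] (rx[ k ] G ≡ r) × r ≤ ℓ

-- "t(n,k,ℓ) exists and equals m"; intended for 2 ≤ k ≤ n and 2 ≤ ℓ ≤ n - 1.
t[_,_,_]≡_ : ℕ → ℕ → ℕ → ℕ → Set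
t[ n , k , ℓ ]≡ m =
  IsLeast (λ e → Σ[ G ∈ Graph n ] Connected G × (rx[ k ] G ≤ ℓ) × size G ≡ e) m

{-# OPTIONS --safe #-}

-- Lower bounds: a list of m edges leaves at least n - m blocks, so a connected
-- graph has at least n - 1 edges. If G is connected with n - 1 edges and two of
-- them share a colour, delete both: at least three blocks remain, and a rainbow
-- tree, using at most one of the two edges, cannot meet all of three. Hence such
-- a G needs n - 1 colours, which also gives the index of the star.
--
-- A graph with n edges and index n - 2 is the 4-cycle 0 - 1 - 3 - 2 - 0, coloured
-- alternately, with n - 4 pendant edges of further colours at 0. Fewer colours do
-- not suffice: the pendant colours are distinct, and unless one of the paths
-- 0 - 1 - 3 and 0 - 2 - 3 adds two new colours, each path is forbidden to the
-- trees through 3 and some p (respectively q) among 0 and the pendant vertices, and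
-- then no rainbow tree contains p, q and 3.

module Submission where

open import Data.Bool.Base using (Bool; true; false; T; not; _∨_)
open import Data.Bool.Properties using (T?; T-∨; T-≡; ¬-not)
import Data.Empty as Empty
open import Data.Fin.Base using (Fin; zero; suc; _<_; punchIn; punchOut; toℕ)
open import Data.Fin.Patterns using (0F; 1F; 2F; 3F)
open import Data.Fin.Properties
  using ( _≟_; _<?_; any?; pigeonhole; injective⇒≤; <-cmp; <-irrefl; <-asym
        ; punchOut-cong; punchOut-injective; punchOut-punchIn; punchInᵢ≢i)
open import Data.Fin.Subset
  using (Subset; inside; outside; _∈_; _∉_; _⊆_; _∪_; ∁; ⁅_⁆; ⊤; ⊥; ∣_∣)
open import Data.Fin.Subset.Properties
  using ( _∈?_; x∈p∪q⁺; x∈⁅x⁆; x∈⁅y⁆⇒x≡y; ∣⁅x⁆∣≡1; ∣⊤∣≡n; ∈⊤; ∉⊥; x∉p⇒x∈∁p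
        ; ⊆-refl; s⊆s)
open import Data.List.Base
  using (List; []; _∷_; _++_; length; lookup; filter; allFin; cartesianProduct)
open import Data.List.Membership.Propositional using () renaming (_∈_ to _∈ˡ_)
open import Data.List.Membership.Propositional.Properties
  using (∈-filter⁺; ∈-filter⁻; ∈-cartesianProduct⁺; ∈-allFin; ∈-lookup)
open import Data.List.Properties using (filter-notAll)
open import Data.List.Relation.Unary.All as All using (All; []; _∷_)
open import Data.List.Relation.Unary.AllPairs using ([]; _∷_)
open import Data.List.Relation.Unary.Any using (here; there) renaming (map to mapAny)
open import Data.List.Relation.Unary.Linked using (Linked; [-]; _∷_)
open import Data.List.Relation.Unary.Unique.Propositional using (Unique)
import Data.List.Relation.Unary.Unique.Propositional.Properties as Unique
open import Data.Nat.Base as ℕ using (ℕ; zero; suc; _≤_; _∸_; _+_; z≤n; s≤s)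
open import Data.Nat.Induction using (<-wellFounded)
import Data.Nat.Properties as ℕ
open import Data.Product.Base using (_×_; _,_; proj₁; proj₂; Σ-syntax; ∃-syntax)
  renaming (swap to swap×)
open import Data.Product.Properties using (≡-dec)
open import Data.Sum.Base using (_⊎_; inj₁; inj₂; [_,_]′; swap)
open import Data.Vec.Base using ([]; _∷_; here; there)
open import Function.Base using (_∘_)
open import Function.Bundles using (Equivalence)
open import Induction.WellFounded using (Acc; acc)
open import Relation.Binary.Construct.Closure.ReflexiveTransitive as Star using (Star; ε; _◅_; _◅◅_)
open import Relation.Binary.Definitions using (tri<; tri≈; tri>)
open import Relation.Binary.PropositionalEquality
  using (_≡_; _≢_; refl; sym; trans; cong; cong₂; subst)
open import Relation.Nullary.Decidable
  using ( Dec; yes; no; does; ¬?; _×-dec_; _⊎-dec_; ⌊_⌋; toWitness; fromWitness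
        ; dec-true; dec-false)
open import Relation.Nullary.Negation using (¬_; contradiction)
open import Defs

open EdgeColoring using (color; color-sym)

private variable
  n k c : ℕ
  A B : Set

-- Lists, walks and finite subsets.

lookup-injective : {xs : List A} → Unique xs → ∀ i j → lookup xs i ≡ lookup xs j → i ≡ j
lookup-injective (_ ∷ _)  zero    zero    _  = refl
lookup-injective (x ∷ _)  zero    (suc j) eq = contradiction eq (All.lookup x (∈-lookup j))
lookup-injective (x ∷ _)  (suc i) zero    eq = contradiction (sym eq) (All.lookup x (∈-lookup i))
lookup-injective (_ ∷ xs) (suc i) (suc j) eq = cong suc (lookup-injective xs i j eq)

Star-constant : {E : A → A → Set} (f : A → B) → (∀ x y → E x y → f x ≡ f y) →
                ∀ {u v} → Star E u v → f u ≡ f v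
Star-constant f const = Star.fold (λ u v → f u ≡ f v) (λ e → trans (const _ _ e)) refl

extend : (p : Subset n) (k : ℕ) → ∣ p ∣ ≤ k → k ≤ n → Σ[ q ∈ Subset n ] p ⊆ q × ∣ q ∣ ≡ k
extend []            zero    _       _         = [] , ⊆-refl , refl
extend (inside ∷ p)  (suc k) (s≤s l) (s≤s k≤n) =
  let q , p⊆q , eq = extend p k l k≤n in inside ∷ q , s⊆s p⊆q , cong suc eq
extend {suc n} (outside ∷ p) k l k≤1+n with ℕ.m≤n⇒m<n∨m≡n k≤1+n
... | inj₁ (s≤s k≤n) = let q , p⊆q , eq = extend p k l k≤n in outside ∷ q , s⊆s p⊆q , eq
... | inj₂ refl      = ⊤ , (λ _ → ∈⊤) , ∣⊤∣≡n (suc n)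

∣p∪q∣≤∣p∣+∣q∣ : (p q : Subset n) → ∣ p ∪ q ∣ ≤ ∣ p ∣ + ∣ q ∣
∣p∪q∣≤∣p∣+∣q∣ []            []            = z≤n
∣p∪q∣≤∣p∣+∣q∣ (inside ∷ p)  (inside ∷ q)  =
  s≤s (ℕ.≤-trans (∣p∪q∣≤∣p∣+∣q∣ p q) (ℕ.+-monoʳ-≤ ∣ p ∣ (ℕ.n≤1+n _)))
∣p∪q∣≤∣p∣+∣q∣ (inside ∷ p)  (outside ∷ q) = s≤s (∣p∪q∣≤∣p∣+∣q∣ p q)
∣p∪q∣≤∣p∣+∣q∣ (outside ∷ p) (inside ∷ q)  =
  ℕ.≤-trans (s≤s (∣p∪q∣≤∣p∣+∣q∣ p q)) (ℕ.≤-reflexive (sym (ℕ.+-suc ∣ p ∣ ∣ q ∣)))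
∣p∪q∣≤∣p∣+∣q∣ (outside ∷ p) (outside ∷ q) = ∣p∪q∣≤∣p∣+∣q∣ p q

∣p∣≡0⇒p≡⊥ : (p : Subset n) → ∣ p ∣ ≡ 0 → p ≡ ⊥
∣p∣≡0⇒p≡⊥ []            _  = refl
∣p∣≡0⇒p≡⊥ (outside ∷ p) eq = cong (outside ∷_) (∣p∣≡0⇒p≡⊥ p eq)

-- Rainbow colourings speak of sets with exactly three elements, while the vertices to be joined may
-- coincide. The union of the singletons is therefore padded by `extend`.
three-element-superset : 3 ≤ n → (x y z : Fin n) →
                         Σ[ S ∈ Subset n ] ∣ S ∣ ≡ 3 × x ∈ S × y ∈ S × z ∈ S
three-element-superset 3≤n x y z = S , eq , p⊆S (x∈p∪q⁺ (inj₁ (x∈⁅x⁆ x))) ,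
  p⊆S (x∈p∪q⁺ (inj₂ (x∈p∪q⁺ (inj₁ (x∈⁅x⁆ y))))) , p⊆S (x∈p∪q⁺ (inj₂ (x∈p∪q⁺ (inj₂ (x∈⁅x⁆ z)))))
  where
  ≤3 : ∣ ⁅ x ⁆ ∪ (⁅ y ⁆ ∪ ⁅ z ⁆) ∣ ≤ 3
  ≤3 = begin
    ∣ ⁅ x ⁆ ∪ (⁅ y ⁆ ∪ ⁅ z ⁆) ∣     ≤⟨ ∣p∪q∣≤∣p∣+∣q∣ ⁅ x ⁆ _ ⟩
    ∣ ⁅ x ⁆ ∣ + ∣ ⁅ y ⁆ ∪ ⁅ z ⁆ ∣   ≤⟨ ℕ.+-monoʳ-≤ ∣ ⁅ x ⁆ ∣ (∣p∪q∣≤∣p∣+∣q∣ ⁅ y ⁆ ⁅ z ⁆) ⟩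
    ∣ ⁅ x ⁆ ∣ + (∣ ⁅ y ⁆ ∣ + ∣ ⁅ z ⁆ ∣) ≡⟨ cong₂ _+_ (∣⁅x⁆∣≡1 x) (cong₂ _+_ (∣⁅x⁆∣≡1 y) (∣⁅x⁆∣≡1 z)) ⟩
    3                               ∎
    where open ℕ.≤-Reasoning
  ext = extend (⁅ x ⁆ ∪ (⁅ y ⁆ ∪ ⁅ z ⁆)) 3 ≤3 3≤n
  S   = proj₁ ext
  p⊆S = proj₁ (proj₂ ext)
  eq  = proj₂ (proj₂ ext)

-- Edge lists and partitions of the vertex set

-- The quotient map that glues `i` to `j`: the label `i` is deleted and its elements receive the new
-- label of `j`.
merge : {i j : Fin (suc k)} → i ≢ j → Fin (suc k) → Fin k
merge {i = i} i≢j x with i ≟ x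
... | yes _  = punchOut i≢j
... | no i≢x = punchOut i≢x

merge-identifies : {i j : Fin (suc k)} (i≢j : i ≢ j) → merge i≢j j ≡ merge i≢j i
merge-identifies {i = i} {j} i≢j with i ≟ j | i ≟ i
... | yes i≡j | _      = contradiction i≡j i≢j
... | no _    | yes _  = punchOut-cong i refl
... | no _    | no i≢i = contradiction refl i≢i

merge-punchIn : {i j : Fin (suc k)} (i≢j : i ≢ j) (y : Fin k) → merge i≢j (punchIn i y) ≡ y
merge-punchIn {i = i} i≢j y with i ≟ punchIn i y
... | yes eq = contradiction (sym eq) (punchInᵢ≢i i y)
... | no _   = trans (punchOut-cong i refl) (punchOut-punchIn i)

-- Blocks are unions of components of the graph with edge list `L`, and `rep` witnesses that none of
-- the `k` blocks is empty.
record Partition {n : ℕ} (L : List (Fin n × Fin n)) (k : ℕ) : Set where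
  field
    block     : Fin n → Fin k
    rep       : Fin k → Fin n
    block-rep : ∀ i → block (rep i) ≡ i
    constant  : ∀ u v → (u , v) ∈ˡ L → block u ≡ block v

-- Starting from singletons, each edge either lies inside a block or merges two blocks, so it costs
-- at most one block.
partition : (L : List (Fin n × Fin n)) → ∃[ k ] Partition L k × n ≤ length L + k
partition {n} [] = n , record
  { block = λ v → v ; rep = λ v → v ; block-rep = λ _ → refl ; constant = λ _ _ () } , ℕ.≤-refl
partition ((u , v) ∷ L) with partition L
... | zero , P , _ = contradiction (Partition.block P u) λ()
... | suc k , P , n≤ with Partition.block P v ≟ Partition.block P u
...   | yes eq = suc k , record
  { block     = block
  ; rep       = rep
  ; block-rep = block-rep
  ; constant  = λ { _ _ (here refl) → sym eq ; x y (there xy∈L) → constant x y xy∈L }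
  } , ℕ.m≤n⇒m≤1+n n≤
  where open Partition P
-- The label `block v` disappears, so `punchIn` keeps the representatives of all the other labels.
...   | no v≢u = k , record
  { block     = merge v≢u ∘ block
  ; rep       = rep ∘ punchIn (block v)
  ; block-rep = λ i → trans (cong (merge v≢u) (block-rep (punchIn (block v) i))) (merge-punchIn v≢u i)
  ; constant  = λ { _ _ (here refl)   → merge-identifies v≢u
                  ; x y (there xy∈L) → cong (merge v≢u) (constant x y xy∈L) }
  } , ℕ.≤-trans n≤ (ℕ.≤-reflexive (ℕ.+-suc (length L) k))
  where open Partition P

edges : Graph n → List (Fin n × Fin n)
edges {n} G =
  filter (λ (u , v) → (u <? v) ×-dec T? (Graph.adj G u v)) (cartesianProduct (allFin n) (allFin n))

module _ (G : Graph n) where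
  private
    edge? = λ ((u , v) : Fin n × Fin n) → (u <? v) ×-dec T? (Graph.adj G u v)

  ∈-edges⁺ : ∀ {u v} → u < v → Adj G u v → (u , v) ∈ˡ edges G
  ∈-edges⁺ u<v uv = ∈-filter⁺ edge? (∈-cartesianProduct⁺ (∈-allFin _) (∈-allFin _)) (u<v , uv)

  ∈-edges⁻ : ∀ {e} → e ∈ˡ edges G → proj₁ e < proj₂ e × Adj G (proj₁ e) (proj₂ e)
  ∈-edges⁻ = proj₂ ∘ ∈-filter⁻ edge? {xs = cartesianProduct (allFin n) (allFin n)}

  edges-unique : Unique (edges G)
  edges-unique = Unique.filter⁺ edge? (Unique.cartesianProduct⁺ (Unique.allFin⁺ n) (Unique.allFin⁺ n))

  -- Choosing for each edge an index that `e` sends to it gives an injection into `Fin k`, because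
  -- `edges G` has no repetitions.
  size-≤ : (e : Fin k → Fin n × Fin n) → (∀ u v → u < v → Adj G u v → ∃[ i ] e i ≡ (u , v)) →
           size G ≤ k
  size-≤ e listed = injective⇒≤ {f = λ i → proj₁ (index i)} λ {i} {j} eq →
    lookup-injective edges-unique i j
      (trans (sym (proj₂ (index i))) (trans (cong e eq) (proj₂ (index j))))
    where
    index : ∀ i → ∃[ j ] e j ≡ lookup (edges G) i
    index i = let u<v , uv = ∈-edges⁻ (∈-lookup i) in listed _ _ u<v uv

  connected⇒n≤1+size : Connected G → n ≤ suc (size G)
  connected⇒n≤1+size conn with partition (edges G)
  ... | k , P , n≤ = ℕ.≤-trans n≤ (ℕ.≤-trans (ℕ.+-monoʳ-≤ (size G) k≤1) (ℕ.≤-reflexive (ℕ.+-comm _ 1)))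
    where
    open Partition P
    adj-constant : ∀ x y → Adj G x y → block x ≡ block y
    adj-constant x y xy with <-cmp x y
    ... | tri< x<y _ _  = constant x y (∈-edges⁺ x<y xy)
    ... | tri≈ _ refl _ = refl
    ... | tri> _ _ y<x  = sym (constant y x (∈-edges⁺ y<x (Graph.sym G x y xy)))
    k≤1 : k ≤ 1
    -- Any two representatives are joined by a walk, along which `block` is constant. Hence even the
    -- constant map to `Fin 1` is injective on blocks.
    k≤1 = injective⇒≤ {f = λ _ → zero} λ {i} {j} _ →
      trans (sym (block-rep i)) (trans (Star-constant block adj-constant (conn _ _)) (block-rep j))

-- Repeated colours in graphs with fewer than n edges.

merge-injective-off : {i j : Fin (suc k)} (i≢j : i ≢ j) (x y : Fin (suc k)) →
                      merge i≢j x ≡ merge i≢j y → x ≡ y ⊎ i ≡ x ⊎ i ≡ y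
merge-injective-off {i = i} i≢j x y eq with i ≟ x | i ≟ y
... | yes i≡x | _       = inj₂ (inj₁ i≡x)
... | no _    | yes i≡y = inj₂ (inj₂ i≡y)
... | no i≢x  | no i≢y  = inj₁ (punchOut-injective i≢x i≢y eq)

-- Every coincidence created by the merge involves `i`, and `i` cannot belong to all three of the
-- pairs {0, 1}, {0, 2} and {1, 2}.
merge-separates : {i j : Fin (3 + k)} (i≢j : i ≢ j) →
                  merge i≢j 0F ≡ merge i≢j 1F → ¬ merge i≢j 0F ≡ merge i≢j 2F
merge-separates i≢j eq₁ eq₂
  with merge-injective-off i≢j 0F 1F eq₁ | merge-injective-off i≢j 0F 2F eq₂
     | merge-injective-off i≢j 1F 2F (trans (sym eq₁) eq₂)
... | inj₂ (inj₁ refl) | _                | inj₂ (inj₁ ())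
... | inj₂ (inj₁ refl) | _                | inj₂ (inj₂ ())
... | inj₂ (inj₂ refl) | inj₂ (inj₁ ())   | _
... | inj₂ (inj₂ refl) | inj₂ (inj₂ ())   | _

-- Since `color-sym` accepts arbitrary adjacency proofs, going to the reversed edge and back
-- replaces one proof by another.
color-irrelevant : {G : Graph n} (χ : EdgeColoring G c) →
                   ∀ u v (p q : Adj G u v) → color χ u v p ≡ color χ u v q
color-irrelevant {G = G} χ u v p q = trans (color-sym χ u v p r) (sym (color-sym χ u v q r))
  where r = Graph.sym G u v p

same-color⇒same-edge : {G : Graph n} (χ : EdgeColoring G c)
  (H : Subgraph G) → IsRainbow χ H → ∀ {u v x y} → Edge H u v → Edge H x y →
  (p : Adj G u v) (q : Adj G x y) → color χ u v p ≡ color χ x y q → (u ≡ x × v ≡ y) ⊎ (u ≡ y × v ≡ x)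
same-color⇒same-edge χ H rainbow e f p q same = rainbow _ _ _ _ e f
  (trans (color-irrelevant χ _ _ _ p) (trans same (color-irrelevant χ _ _ q _)))

infix 4 _≟ₑ_
_≟ₑ_ : (e f : Fin n × Fin n) → Dec (e ≡ f)
_≟ₑ_ = ≡-dec _≟_ _≟_

without : Fin n × Fin n → List (Fin n × Fin n) → List (Fin n × Fin n)
without e = filter (λ f → ¬? (f ≟ₑ e))

length-without : ∀ {e} {L : List (Fin n × Fin n)} → e ∈ˡ L → length (without e L) ℕ.< length L
length-without {e = e} e∈L = filter-notAll (λ f → ¬? (f ≟ₑ e)) _
  (mapAny (λ e≡f ¬f≡e → ¬f≡e (sym e≡f)) e∈L)

∈-without : ∀ {e f} {L : List (Fin n × Fin n)} → f ∈ˡ L → f ≢ e → f ∈ˡ without e L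
∈-without {e = e} = ∈-filter⁺ (λ f → ¬? (f ≟ₑ e))

module _ {G : Graph n} (χ : EdgeColoring G c)
         {u v x y : Fin n} (e∈G : (u , v) ∈ˡ edges G) (f∈G : (x , y) ∈ˡ edges G)
         (e≢f : (u , v) ≢ (x , y)) where
  private
    L = without (u , v) (without (x , y) (edges G))

  rainbow-misses : (p : Adj G u v) (q : Adj G x y) → color χ u v p ≡ color χ x y q →
                   (H : Subgraph G) → IsRainbow χ H → ¬ Edge H u v ⊎ ¬ Edge H x y
  rainbow-misses p q same H rainbow with T? (Subgraph.edge H u v) | T? (Subgraph.edge H x y)
  ... | no ¬e | _     = inj₁ ¬e
  ... | yes _ | no ¬f = inj₂ ¬f
  ... | yes e | yes f with same-color⇒same-edge χ H rainbow e f p q same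
  ...   | inj₁ (refl , refl) = contradiction refl e≢f
  -- Both pairs are listed with the smaller end first, so neither is the reversal of the other.
  ...   | inj₂ (refl , refl) =
    contradiction (proj₁ (∈-edges⁻ G f∈G)) (<-asym (proj₁ (∈-edges⁻ G e∈G)))

  -- Here (`a`, `b`) is the one deleted edge that `H` may still use. Edges of `H` come in both
  -- directions and are sorted before being looked up.
  edge-constant : (H : Subgraph G) {a b : Fin n} →
    (∀ s t → Edge H s t → (s , t) ∈ˡ edges G → (s , t) ∈ˡ L ⊎ (s , t) ≡ (a , b)) →
    (g : Fin n → A) → (∀ s t → (s , t) ∈ˡ L → g s ≡ g t) → g a ≡ g b →
    ∀ s t → Edge H s t → g s ≡ g t
  edge-constant H H⊆ g const ga≡gb s t st with <-cmp s t
  ... | tri≈ _ refl _ = refl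
  ... | tri< s<t _ _ with H⊆ s t st (∈-edges⁺ G s<t (Subgraph.edge⇒adj H s t st))
  ...   | inj₁ st∈L = const s t st∈L
  ...   | inj₂ refl = ga≡gb
  edge-constant H H⊆ g const ga≡gb s t st | tri> _ _ t<s
    with ts ← Subgraph.edge-sym H s t st
    with H⊆ t s ts (∈-edges⁺ G t<s (Subgraph.edge⇒adj H t s ts))
  ...   | inj₁ ts∈L = sym (const t s ts∈L)
  ...   | inj₂ refl = sym ga≡gb

  length-L : 2 + length L ≤ size G
  length-L = ℕ.≤-trans (s≤s (length-without (∈-without e∈G e≢f))) (length-without f∈G)

  -- If `a` and `b` share a block, `H` never leaves a block of `P`. Otherwise `H` stays within the
  -- blocks obtained by merging those of `a` and `b`, and this single merge cannot unite three
  -- blocks.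
  three-blocks-not-joined : (P : Partition L (3 + k)) (H : Subgraph G) (a b : Fin n) →
    (∀ s t → Edge H s t → (s , t) ∈ˡ edges G → (s , t) ∈ˡ L ⊎ (s , t) ≡ (a , b)) →
    Star (Edge H) (Partition.rep P 0F) (Partition.rep P 1F) →
    ¬ Star (Edge H) (Partition.rep P 0F) (Partition.rep P 2F)
  three-blocks-not-joined P H a b H⊆ s₁ s₂ with Partition.block P b ≟ Partition.block P a
  ... | yes b≡a =
    contradiction (trans (sym (block-rep 0F)) (trans (constant-on-H s₁) (block-rep 1F))) λ()
    where
    open Partition P
    constant-on-H : ∀ {s t} → Star (Edge H) s t → block s ≡ block t
    constant-on-H = Star-constant block (edge-constant H H⊆ block constant (sym b≡a))
  ... | no b≢a = merge-separates b≢a (joined 1F s₁) (joined 2F s₂)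
    where
    open Partition P
    joined : ∀ i → Star (Edge H) (rep 0F) (rep i) → merge b≢a 0F ≡ merge b≢a i
    joined i star = trans (sym (cong (merge b≢a) (block-rep 0F)))
      (trans (Star-constant (merge b≢a ∘ block)
               (edge-constant H H⊆ (merge b≢a ∘ block)
                 (λ s t st → cong (merge b≢a) (constant s t st)) (merge-identifies b≢a)) star)
             (cong (merge b≢a) (block-rep i)))

  size<n⇒same-color-impossible : 3 ≤ n → size G ℕ.< n → IsRainbowColoring 3 χ →
    (p : Adj G u v) (q : Adj G x y) → ¬ color χ u v p ≡ color χ x y q
  size<n⇒same-color-impossible 3≤n size<n rainbow p q same with partition L
  -- Two of at most n - 1 edges are gone, so at least three blocks remain.
  ... | k , P , n≤ with ℕ.+-cancelˡ-≤ (length L) 3 k (begin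
      length L + 3      ≡⟨ ℕ.+-comm (length L) 3 ⟩
      3 + length L      ≤⟨ s≤s length-L ⟩
      suc (size G)      ≤⟨ size<n ⟩
      n                 ≤⟨ n≤ ⟩
      length L + k      ∎)
    where open ℕ.≤-Reasoning
  ...   | s≤s (s≤s (s≤s z≤n))
        with three-element-superset 3≤n (Partition.rep P 0F) (Partition.rep P 1F) (Partition.rep P 2F)
  ...     | S , ∣S∣≡3 , r₀ , r₁ , r₂ with rainbow S ∣S∣≡3
  ...       | H , tree , H-rainbow , S⊆H with rainbow-misses p q same H H-rainbow
  ...         | inj₁ ¬e = three-blocks-not-joined P H x y H⊆
                            (connected _ _ (S⊆H r₀) (S⊆H r₁)) (connected _ _ (S⊆H r₀) (S⊆H r₂))
    where
    open IsTree tree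
    H⊆ : ∀ s t → Edge H s t → (s , t) ∈ˡ edges G → (s , t) ∈ˡ L ⊎ (s , t) ≡ (x , y)
    H⊆ s t st st∈G with (s , t) ≟ₑ (x , y)
    ... | yes st≡xy = inj₂ st≡xy
    ... | no st≢xy  = inj₁ (∈-without (∈-without st∈G st≢xy) λ { refl → ¬e st })
  ...         | inj₂ ¬f = three-blocks-not-joined P H u v H⊆
                            (connected _ _ (S⊆H r₀) (S⊆H r₁)) (connected _ _ (S⊆H r₀) (S⊆H r₂))
    where
    open IsTree tree
    H⊆ : ∀ s t → Edge H s t → (s , t) ∈ˡ edges G → (s , t) ∈ˡ L ⊎ (s , t) ≡ (u , v)
    H⊆ s t st st∈G with (s , t) ≟ₑ (u , v)
    ... | yes st≡uv = inj₂ st≡uv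
    ... | no st≢uv  = inj₁ (∈-without (∈-without st∈G λ { refl → ¬f st }) st≢uv)

-- With fewer than n - 1 colours, the at least n - 1 edges of a connected graph would include two of
-- the same colour, by the pigeonhole principle.
size<n⇒n≤1+colors : {G : Graph n} → 3 ≤ n → Connected G → size G ℕ.< n →
                    (χ : EdgeColoring G c) → IsRainbowColoring 3 χ → n ≤ suc c
size<n⇒n≤1+colors {n} {c} {G} 3≤n conn size<n χ rainbow with ℕ.≤-<-connex n (suc c)
... | inj₁ n≤1+c = n≤1+c
... | inj₂ 1+c<n with pigeonhole (ℕ.≤-pred (ℕ.≤-trans 1+c<n (connected⇒n≤1+size G conn))) color-of
  where
  color-of : Fin (size G) → Fin c
  color-of i = color χ _ _ (proj₂ (∈-edges⁻ G (∈-lookup i)))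
...   | i , j , i<j , same =
  contradiction same (size<n⇒same-color-impossible χ (∈-lookup i) (∈-lookup j)
    (λ eq → <-irrefl (lookup-injective (edges-unique G) i j eq) i<j)
    3≤n size<n rainbow _ _)

-- Trees given by a parent function

-- A walk without backtracking, indexed by its first and its last edge.
data Walk (E : A → A → Set) : A → A → A → A → Set where
  edge : ∀ {x y} → E x y → Walk E x y x y
  step : ∀ {x y z s t} → E x y → x ≢ z → Walk E y z s t → Walk E x y s t

first-edge : ∀ {E : A → A → Set} {x y s t} → Walk E x y s t → E x y
first-edge (edge xy)     = xy
first-edge (step xy _ _) = xy

-- Distinctness of the vertices excludes backtracking. The last vertex `s` before `z` is located in
-- the list so that it can be told apart from the second vertex of the cycle.
cycle-walk : ∀ {E : A → A → Set} x y ys z → Linked E (x ∷ y ∷ ys ++ z ∷ []) → Unique (x ∷ y ∷ ys) →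
             All (z ≢_) (x ∷ y ∷ ys) → ∃[ s ] Walk E x y s z × s ∈ˡ y ∷ ys
cycle-walk x y [] z (xy ∷ yz ∷ [-]) _ (z≢x ∷ _) = y , step xy (z≢x ∘ sym) (edge yz) , here refl
cycle-walk x y (y′ ∷ ys) z (xy ∷ linked) ((_ ∷ x≢y′ ∷ _) ∷ unique) (_ ∷ z∉) =
  let s , walk , s∈ = cycle-walk y y′ ys z linked unique z∉ in s , step xy x≢y′ walk , there s∈

module _ {E : A → A → Set} (parent : A → A) (rank : A → ℕ)
         (parental : ∀ {x y} → E x y →
                     (x ≡ parent y × rank x ℕ.< rank y) ⊎ (y ≡ parent x × rank y ℕ.< rank x)) where

  -- Turning from downwards to upwards would be backtracking.
  stays-down : ∀ {x y s t} → Walk E x y s t → x ≡ parent y → rank x ℕ.< rank y →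
               s ≡ parent t × rank x ℕ.< rank t
  stays-down (edge _)       x≡py x<y = x≡py , x<y
  stays-down (step _ x≢z w) x≡py x<y with parental (first-edge w)
  ... | inj₁ (y≡pz , y<z) = let s≡pt , y<t = stays-down w y≡pz y<z in s≡pt , ℕ.<-trans x<y y<t
  ... | inj₂ (z≡py , _)   = contradiction (trans x≡py (sym z≡py)) x≢z

  -- A walk climbs towards the root for a while and never climbs again after turning down. If it
  -- never turns, its rank falls throughout.
  ends-down-or-descends : ∀ {x y s t} → Walk E x y s t → s ≡ parent t ⊎ rank t ℕ.< rank x
  ends-down-or-descends w with parental (first-edge w)
  ... | inj₁ (x≡py , x<y) = inj₁ (proj₁ (stays-down w x≡py x<y))
  ends-down-or-descends (edge _)     | inj₂ (_ , y<x) = inj₂ y<x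
  ends-down-or-descends (step _ _ w) | inj₂ (_ , y<x) with ends-down-or-descends w
  ... | inj₁ s≡pt = inj₁ s≡pt
  ... | inj₂ t<y  = inj₂ (ℕ.<-trans t<y y<x)

  -- Starting downwards, the walk would return to `x` with a larger rank. Starting upwards, it must
  -- end downwards, and then `y` and `s` are both the parent of `x`.
  no-closed-walk : ∀ {x y s} → Walk E x y s x → y ≢ s → Empty.⊥
  no-closed-walk w y≢s with parental (first-edge w)
  ... | inj₁ (x≡py , x<y) = ℕ.<-irrefl refl (proj₂ (stays-down w x≡py x<y))
  ... | inj₂ (y≡px , _) with ends-down-or-descends w
  ...   | inj₁ s≡px = y≢s (trans y≡px (sym s≡px))
  ...   | inj₂ x<x  = ℕ.<-irrefl refl x<x

-- The strict decrease of `rank` towards the root serves twice: following parents reaches `root`,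
-- which gives connectedness, and no cycle can close up.
module ParentTree (G : Graph n) (V : Subset n) (root : Fin n) (parent : Fin n → Fin n)
  (rank : Fin n → ℕ)
  (descends : ∀ v → v ∈ V → v ≢ root → parent v ∈ V × rank (parent v) ℕ.< rank v × Adj G (parent v) v)
  where

  Arc : Fin n → Fin n → Set
  Arc u v = (v ∈ V × v ≢ root) × u ≡ parent v

  edge? : ∀ u v → Dec (Arc u v ⊎ Arc v u)
  edge? u v = arc? u v ⊎-dec arc? v u
    where
    arc? : ∀ u v → Dec (Arc u v)
    arc? u v = ((v ∈? V) ×-dec ¬? (v ≟ root)) ×-dec (u ≟ parent v)

  edge-cases : ∀ {u v} → T ⌊ edge? u v ⌋ → Arc u v ⊎ Arc v u
  edge-cases = toWitness

  subgraph : Subgraph G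
  subgraph = record
    { vertices = V
    ; edge     = λ u v → ⌊ edge? u v ⌋
    ; edge-sym = λ u v → fromWitness ∘ swap ∘ edge-cases
    ; edge⇒adj = λ u v → [ arc⇒adj , Graph.sym G v u ∘ arc⇒adj ]′ ∘ edge-cases
    ; edge⇒∈   = λ u v → [ (λ { ((v∈V , v≢r) , refl) → proj₁ (descends v v∈V v≢r) })
                         , proj₁ ∘ proj₁ ]′ ∘ edge-cases
    }
    where
    arc⇒adj : ∀ {u v} → Arc u v → Adj G u v
    arc⇒adj ((v∈V , v≢r) , refl) = proj₂ (proj₂ (descends _ v∈V v≢r))

  open Subgraph subgraph using (edge-sym; edge⇒adj)

  to-root : ∀ v → v ∈ V → Star (Edge subgraph) v root
  to-root v = go v (<-wellFounded (rank v))
    where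
    go : ∀ v → Acc ℕ._<_ (rank v) → v ∈ V → Star (Edge subgraph) v root
    go v (acc rec) v∈V with v ≟ root
    ... | yes refl = ε
    ... | no v≢r   = let p∈V , p<v , _ = descends v v∈V v≢r in
      fromWitness {a? = edge? v (parent v)} (inj₂ ((v∈V , v≢r) , refl)) ◅ go (parent v) (rec p<v) p∈V

  isTree : IsTree subgraph
  isTree = record
    { connected = λ u v u∈V v∈V → to-root u u∈V ◅◅ Star.reverse (edge-sym _ _) (to-root v v∈V)
    ; acyclic   = acyclic
    }
    where
    parental : ∀ {x y} → Edge subgraph x y →
               (x ≡ parent y × rank x ℕ.< rank y) ⊎ (y ≡ parent x × rank y ℕ.< rank x)
    parental xy with edge-cases xy
    ... | inj₁ ((y∈V , y≢r) , refl) = inj₁ (refl , proj₁ (proj₂ (descends _ y∈V y≢r)))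
    ... | inj₂ ((x∈V , x≢r) , refl) = inj₂ (refl , proj₁ (proj₂ (descends _ x∈V x≢r)))

    acyclic : ∀ v₀ vs → ¬ IsCycle (Edge subgraph) v₀ vs
    acyclic v₀ (_ ∷ [])       (s≤s () , _)
    acyclic v₀ (v₁ ∷ v₂ ∷ vs) (_ , (v₀∉@(_ ∷ v₀≢v₂ ∷ _) ∷ unique@(v₁∉ ∷ _)) , e ∷ linked) =
      let s , walk , s∈ = cycle-walk v₁ v₂ vs v₀ linked unique v₀∉
      in no-closed-walk parent rank parental (step e v₀≢v₂ walk) (All.lookup v₁∉ s∈)

  -- A certificate for being rainbow: if the colour of a tree edge determines its child end, it
  -- determines the edge, since the other end is the parent.
  module _ (χ : EdgeColoring G c)
    (decode : Fin c → Fin n)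
    (decodes : ∀ v → v ∈ V → v ≢ root → ∀ p → decode (color χ (parent v) v p) ≡ v) where

    private
      arcs-agree : ∀ {u v x y} → Arc u v → Arc x y → ∀ p q →
                   color χ u v p ≡ color χ x y q → u ≡ x × v ≡ y
      arcs-agree ((v∈V , v≢r) , refl) ((y∈V , y≢r) , refl) p q eq
        with trans (sym (decodes _ v∈V v≢r p)) (trans (cong decode eq) (decodes _ y∈V y≢r q))
      ... | refl = refl , refl

    isRainbow : IsRainbow χ subgraph
    isRainbow u v x y e f eq with edge-cases e | edge-cases f
    ... | inj₁ uv | inj₁ xy = inj₁ (arcs-agree uv xy _ _ eq)
    ... | inj₁ uv | inj₂ yx = inj₂ (arcs-agree uv yx _ (edge⇒adj y x (edge-sym x y f))
                                      (trans eq (color-sym χ x y _ _)))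
    ... | inj₂ vu | inj₁ xy = inj₂ (swap× (arcs-agree vu xy (edge⇒adj v u (edge-sym u v e)) _
                                      (trans (color-sym χ v u _ _) eq)))
    ... | inj₂ vu | inj₂ yx = inj₁ (swap× (arcs-agree vu yx (edge⇒adj v u (edge-sym u v e))
                                      (edge⇒adj y x (edge-sym x y f))
                                      (trans (color-sym χ v u _ _) (trans eq (color-sym χ x y _ _)))))

    rainbowTree : ∀ {S} → S ⊆ V → RainbowSTree χ S
    rainbowTree S⊆V = subgraph , isTree , isRainbow , S⊆V

-- The two extremal graphs

module FromArcs (arc : Fin n → Fin n → Bool) (increasing : ∀ u v → T (arc u v) → u < v) where

  either : ∀ u v → T (arc u v ∨ arc v u) → T (arc u v) ⊎ T (arc v u)
  either u v = Equivalence.to T-∨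

  graph : Graph n
  graph = record
    { adj    = λ u v → arc u v ∨ arc v u
    ; sym    = λ u v → Equivalence.from T-∨ ∘ swap ∘ either u v
    ; irrefl = λ u → [ <-irrefl refl ∘ increasing u u , <-irrefl refl ∘ increasing u u ]′ ∘ either u u
    }

  sorted : ∀ {u v} → u < v → Adj graph u v → T (arc u v)
  sorted {u} {v} u<v uv with either u v uv
  ... | inj₁ a = a
  ... | inj₂ a = contradiction u<v (<-asym (increasing v u a))

  connected-via : (z : Fin n) → (∀ u → Star (Adj graph) u z) → Connected graph
  connected-via z to-z u v = to-z u ◅◅ Star.reverse (λ {x} {y} → Graph.sym graph x y) (to-z v)

-- The star.

module StarGraph (k : ℕ) where

  arc : Fin (suc k) → Fin (suc k) → Bool
  arc zero (suc _) = true
  arc _    _       = false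

  increasing : ∀ u v → T (arc u v) → u < v
  increasing zero (suc _) _ = s≤s z≤n

  open FromArcs arc increasing public using (graph; sorted; connected-via)

  connected : Connected graph
  connected = connected-via zero λ { zero → ε ; (suc _) → _ ◅ ε }

  size≤ : size graph ≤ k
  size≤ = size-≤ graph (λ j → zero , suc j) λ u v u<v uv → listed u v (sorted u<v uv)
    where
    listed : ∀ u v → T (arc u v) → ∃[ j ] (zero , suc j) ≡ (u , v)
    listed zero (suc j) _ = j , refl

  coloring : EdgeColoring graph k
  coloring = record
    { color     = λ { zero (suc j) _ → j ; (suc j) zero _ → j }
    ; color-sym = λ { zero (suc _) _ _ → refl ; (suc _) zero _ _ → refl }
    }

  -- The edges of the star all have different colours, so the whole star serves for every `S`.
  isRainbowColoring : IsRainbowColoring 3 coloring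
  isRainbowColoring S _ = rainbowTree coloring suc decodes λ _ → ∈⊤
    where
    decodes : ∀ v → v ∈ ⊤ → v ≢ zero → ∀ p → suc (color coloring zero v p) ≡ v
    decodes zero    _ 0≢0 _ = contradiction refl 0≢0
    decodes (suc _) _ _   _ = refl
    parent : Fin (suc k) → Fin (suc k)
    parent _ = zero
    descends : ∀ v → v ∈ ⊤ → v ≢ zero → parent v ∈ ⊤ × toℕ (parent v) ℕ.< toℕ v × Adj graph (parent v) v
    descends zero    _ 0≢0 = contradiction refl 0≢0
    descends (suc _) _ _   = here , s≤s z≤n , _
    open ParentTree graph ⊤ zero parent toℕ descends

-- The 4-cycle with pendant edges.

module PendantSquare (m : ℕ) where

  pattern pendant j = suc (suc (suc (suc j)))

  -- Matching on a `Link` meets only the actual edges, instead of all pairs of vertices as with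
  -- `arc`.
  data Link : Fin (4 + m) → Fin (4 + m) → Set where
    link₀₁ : Link 0F 1F
    link₀₂ : Link 0F 2F
    link₁₃ : Link 1F 3F
    link₂₃ : Link 2F 3F
    link₀  : ∀ j → Link 0F (pendant j)

  arc : Fin (4 + m) → Fin (4 + m) → Bool
  arc 0F 1F          = true
  arc 0F 2F          = true
  arc 1F 3F          = true
  arc 2F 3F          = true
  arc 0F (pendant _) = true
  arc _  _           = false

  link : ∀ u v → T (arc u v) → Link u v
  link 0F 1F          _ = link₀₁
  link 0F 2F          _ = link₀₂
  link 0F (pendant j) _ = link₀ j
  link 1F 3F          _ = link₁₃
  link 2F 3F          _ = link₂₃

  link-increasing : ∀ {u v} → Link u v → u < v
  link-increasing link₀₁    = s≤s z≤n
  link-increasing link₀₂    = s≤s z≤n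
  link-increasing link₁₃    = s≤s (s≤s z≤n)
  link-increasing link₂₃    = s≤s (s≤s (s≤s z≤n))
  link-increasing (link₀ _) = s≤s z≤n

  open FromArcs arc (λ u v → link-increasing ∘ link u v) public
    using (graph; either; sorted; connected-via)

  connected : Connected graph
  connected = connected-via 0F λ
    { 0F → ε ; 1F → _ ◅ ε ; 2F → _ ◅ ε ; 3F → _◅_ {j = 1F} _ (_ ◅ ε) ; (pendant _) → _ ◅ ε }

  size≤ : size graph ≤ 4 + m
  size≤ = size-≤ graph edge-at λ u v u<v uv → listed (link u v (sorted u<v uv))
    where
    edge-at : Fin (4 + m) → Fin (4 + m) × Fin (4 + m)
    edge-at 0F          = 2F , 3F
    edge-at 1F          = 0F , 1F
    edge-at 2F          = 0F , 2F
    edge-at 3F          = 1F , 3F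
    edge-at (pendant j) = 0F , pendant j
    listed : ∀ {u v} → Link u v → ∃[ i ] edge-at i ≡ (u , v)
    listed link₀₁    = 1F , refl
    listed link₀₂    = 2F , refl
    listed link₁₃    = 3F , refl
    listed link₂₃    = 0F , refl
    listed (link₀ j) = pendant j , refl

  -- Opposite edges of the square share a hue. The default `1F` is the hue of 0 - 2 and 1 - 3.
  hue : Fin (4 + m) → Fin (4 + m) → Fin (2 + m)
  hue 0F          1F          = 0F
  hue 1F          0F          = 0F
  hue 2F          3F          = 0F
  hue 3F          2F          = 0F
  hue (pendant j) _           = suc (suc j)
  hue _           (pendant j) = suc (suc j)
  hue _           _           = 1F

  hue-sym : ∀ {u v} → Link u v → hue u v ≡ hue v u
  hue-sym link₀₁    = refl
  hue-sym link₀₂    = refl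
  hue-sym link₁₃    = refl
  hue-sym link₂₃    = refl
  hue-sym (link₀ _) = refl

  coloring : EdgeColoring graph (2 + m)
  coloring = record
    { color     = λ u v _ → hue u v
    ; color-sym = λ u v uv _ → [ hue-sym ∘ link u v , sym ∘ hue-sym ∘ link v u ]′ (either u v uv)
    }

  -- The child end of the tree edge of a given hue; a and b are the children of
  -- the two square edges of the tree.
  decode : Fin (4 + m) → Fin (4 + m) → Fin (2 + m) → Fin (4 + m)
  decode a b 0F            = a
  decode a b 1F            = b
  decode a b (suc (suc j)) = pendant j

  module _ {S : Subset (4 + m)} where

    avoids : ∀ {w} → w ∉ S → S ⊆ ∁ ⁅ w ⁆
    avoids {w} w∉S x∈S = x∉p⇒x∈∁p λ x∈w → w∉S (subst (_∈ S) (x∈⁅y⁆⇒x≡y w x∈w) x∈S)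

    tree-avoiding-1 : 1F ∉ S → RainbowSTree coloring S
    -- From the root 0, the edge of hue `0F` is 2 - 3 with child 3, and that of hue `1F` is 0 - 2
    -- with child 2.
    tree-avoiding-1 1∉S = rainbowTree coloring (decode 3F 2F)
      (λ { 0F _ 0≢0 _ → contradiction refl 0≢0 ; 1F (there ()) ; 2F _ _ _ → refl
         ; 3F _ _ _ → refl ; (pendant _) _ _ _ → refl })
      (avoids 1∉S)
      where
      parent : Fin (4 + m) → Fin (4 + m)
      parent 3F = 2F
      parent _  = 0F
      descends : ∀ v → v ∈ ∁ ⁅ 1F ⁆ → v ≢ 0F →
                 parent v ∈ ∁ ⁅ 1F ⁆ × toℕ (parent v) ℕ.< toℕ v × Adj graph (parent v) v
      descends 0F _ 0≢0 = contradiction refl 0≢0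
      descends 1F (there ())
      descends 2F _ _ = here , s≤s z≤n , _
      descends 3F _ _ = there (there here) , s≤s (s≤s (s≤s z≤n)) , _
      descends (pendant _) _ _ = here , s≤s z≤n , _
      open ParentTree graph (∁ ⁅ 1F ⁆) 0F parent toℕ descends

    tree-avoiding-2 : 2F ∉ S → RainbowSTree coloring S
    tree-avoiding-2 2∉S = rainbowTree coloring (decode 1F 3F)
      (λ { 0F _ 0≢0 _ → contradiction refl 0≢0 ; 1F _ _ _ → refl ; 2F (there (there ()))
         ; 3F _ _ _ → refl ; (pendant _) _ _ _ → refl })
      (avoids 2∉S)
      where
      parent : Fin (4 + m) → Fin (4 + m)
      parent 3F = 1F
      parent _  = 0F
      descends : ∀ v → v ∈ ∁ ⁅ 2F ⁆ → v ≢ 0F →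
                 parent v ∈ ∁ ⁅ 2F ⁆ × toℕ (parent v) ℕ.< toℕ v × Adj graph (parent v) v
      descends 0F _ 0≢0 = contradiction refl 0≢0
      descends 1F _ _ = here , s≤s z≤n , _
      descends 2F (there (there ()))
      descends 3F _ _ = there here , s≤s (s≤s z≤n) , _
      descends (pendant _) _ _ = here , s≤s z≤n , _
      open ParentTree graph (∁ ⁅ 2F ⁆) 0F parent toℕ descends

    tree-avoiding-3 : 3F ∉ S → RainbowSTree coloring S
    tree-avoiding-3 3∉S = rainbowTree coloring (decode 1F 2F)
      (λ { 0F _ 0≢0 _ → contradiction refl 0≢0 ; 1F _ _ _ → refl ; 2F _ _ _ → refl
         ; 3F (there (there (there ()))) ; (pendant _) _ _ _ → refl })
      (avoids 3∉S)
      where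
      parent : Fin (4 + m) → Fin (4 + m)
      parent _ = 0F
      descends : ∀ v → v ∈ ∁ ⁅ 3F ⁆ → v ≢ 0F →
                 parent v ∈ ∁ ⁅ 3F ⁆ × toℕ (parent v) ℕ.< toℕ v × Adj graph (parent v) v
      descends 0F _ 0≢0 = contradiction refl 0≢0
      descends 1F _ _ = here , s≤s z≤n , _
      descends 2F _ _ = here , s≤s z≤n , _
      descends 3F (there (there (there ())))
      descends (pendant _) _ _ = here , s≤s z≤n , _
      open ParentTree graph (∁ ⁅ 3F ⁆) 0F parent toℕ descends

  -- The path 1 - 3 - 2 is rooted at its middle vertex 3, whose number exceeds those of its
  -- children; hence a separate `rank` in place of `toℕ`.
  path-132 : RainbowSTree coloring (outside ∷ inside ∷ inside ∷ inside ∷ ⊥)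
  path-132 = rainbowTree coloring (decode 2F 1F)
    (λ { 1F _ _ _ → refl ; 2F _ _ _ → refl ; 3F _ 3≢3 _ → contradiction refl 3≢3
       ; (pendant _) (there (there (there (there ∈⊥)))) → contradiction ∈⊥ ∉⊥ })
    ⊆-refl
    where
    rank : Fin (4 + m) → ℕ
    rank 3F = 0
    rank _  = 1
    path : Subset (4 + m)
    path = outside ∷ inside ∷ inside ∷ inside ∷ ⊥
    descends : ∀ v → v ∈ path → v ≢ 3F → 3F ∈ path × 0 ℕ.< rank v × Adj graph 3F v
    descends 1F _ _   = there (there (there here)) , s≤s z≤n , _
    descends 2F _ _   = there (there (there here)) , s≤s z≤n , _
    descends 3F _ 3≢3 = contradiction refl 3≢3
    descends (pendant _) (there (there (there (there ∈⊥)))) = contradiction ∈⊥ ∉⊥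
    parent : Fin (4 + m) → Fin (4 + m)
    parent _ = 3F
    open ParentTree graph path 3F parent rank descends

  -- A 3-subset either misses some w ∈ {1, 2, 3}, and then G - w is a tree
  -- containing it, or is {1, 2, 3}.
  isRainbowColoring : IsRainbowColoring 3 coloring
  isRainbowColoring (_ ∷ outside ∷ _) _ = tree-avoiding-1 λ { (there ()) }
  isRainbowColoring (_ ∷ inside ∷ outside ∷ _) _ = tree-avoiding-2 λ { (there (there ())) }
  isRainbowColoring (_ ∷ inside ∷ inside ∷ outside ∷ _) _ =
    tree-avoiding-3 λ { (there (there (there ()))) }
  isRainbowColoring (outside ∷ inside ∷ inside ∷ inside ∷ p) eq
    with refl ← ∣p∣≡0⇒p≡⊥ p (ℕ.+-cancelˡ-≡ 3 _ _ eq) = path-132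

  -- The number of colours needed by the square with pendant edges.

  -- The vertices from which 3 is reached only through one of the paths 0 - 1 - 3 and 0 - 2 - 3.
  lobby : Fin (suc m) → Fin (4 + m)
  lobby zero    = 0F
  lobby (suc j) = pendant j

  module _ {H : Subgraph graph} (tree : IsTree H) where

    open IsTree tree using () renaming (connected to H-connected)

    -- Used with `f` as a cut: if `f` separates two vertices of the tree, some tree edge crosses the
    -- cut.
    constant-on-tree : (f : Fin (4 + m) → Bool) → (∀ {u v} → Link u v → Edge H u v → f u ≡ f v) →
                       ∀ {u v} → u ∈ vertices H → v ∈ vertices H → f u ≡ f v
    constant-on-tree f const u∈H v∈H = Star-constant f on-edges (H-connected _ _ u∈H v∈H)
      where
      on-edges : ∀ u v → Edge H u v → f u ≡ f v
      on-edges u v uv with either u v (Subgraph.edge⇒adj H u v uv)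
      ... | inj₁ a = const (link u v a) uv
      ... | inj₂ a = sym (const (link v u a) (Subgraph.edge-sym H u v uv))

    pendant-edge : ∀ {j} → pendant j ∈ vertices H → 3F ∈ vertices H → Edge H 0F (pendant j)
    pendant-edge {j} j∈H 3∈H with T? (Subgraph.edge H 0F (pendant j))
    ... | yes e = e
    ... | no ¬e = contradiction (trans (sym (dec-true (j ≟ j) refl))
                                       (constant-on-tree side const j∈H 3∈H)) λ()
      where
      -- The cut isolates `pendant j`, whose only link is to 0.
      side : Fin (4 + m) → Bool
      side (pendant i) = does (i ≟ j)
      side _           = false
      const : ∀ {u v} → Link u v → Edge H u v → side u ≡ side v
      const link₀₁    _ = refl
      const link₀₂    _ = refl
      const link₁₃    _ = refl
      const link₂₃    _ = refl
      const (link₀ i) e = sym (dec-false (i ≟ j) λ { refl → ¬e e })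

    crosses-square : ∀ {i} → lobby i ∈ vertices H → 3F ∈ vertices H →
                     (Edge H 0F 1F × Edge H 1F 3F) ⊎ (Edge H 0F 2F × Edge H 2F 3F)
    crosses-square {i} i∈H 3∈H
      with T? (Subgraph.edge H 0F 1F) ×-dec T? (Subgraph.edge H 1F 3F)
         | T? (Subgraph.edge H 0F 2F) ×-dec T? (Subgraph.edge H 2F 3F)
    ... | yes via-1 | _         = inj₁ via-1
    ... | no _      | yes via-2 = inj₂ via-2
    ... | no ¬via-1 | no ¬via-2 =
      contradiction (trans (sym (side-lobby i)) (constant-on-tree side const i∈H 3∈H)) λ()
      where
      -- Each of 1 and 2 is put on the side of 0 if the tree joins it to 0, and on the side of 3
      -- otherwise. A tree edge across this cut would complete one of the two paths.
      side : Fin (4 + m) → Bool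
      side 1F = not (Subgraph.edge H 0F 1F)
      side 2F = not (Subgraph.edge H 0F 2F)
      side 3F = true
      side _  = false
      side-lobby : ∀ i → side (lobby i) ≡ false
      side-lobby zero    = refl
      side-lobby (suc _) = refl
      const : ∀ {u v} → Link u v → Edge H u v → side u ≡ side v
      const link₀₁    e = sym (cong not (Equivalence.to T-≡ e))
      const link₀₂    e = sym (cong not (Equivalence.to T-≡ e))
      const link₁₃    e = cong not (¬-not λ eq → ¬via-1 (Equivalence.from T-≡ eq , e))
      const link₂₃    e = cong not (¬-not λ eq → ¬via-2 (Equivalence.from T-≡ eq , e))
      const (link₀ _) _ = refl

  module _ (χ : EdgeColoring graph c) (rainbow : IsRainbowColoring 3 χ) where

    pendant-color : Fin m → Fin c
    pendant-color j = color χ 0F (pendant j) _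

    -- A tree through both pendant vertices and 3 must use both pendant edges.
    pendant-color-injective : ∀ i j → pendant-color i ≡ pendant-color j → i ≡ j
    pendant-color-injective i j eq
      with three-element-superset (s≤s (s≤s (s≤s z≤n))) (pendant i) (pendant j) 3F
    ... | S , ∣S∣≡3 , i∈S , j∈S , 3∈S with rainbow S ∣S∣≡3
    ...   | H , tree , H-rainbow , S⊆H
      with same-color⇒same-edge χ H H-rainbow (pendant-edge tree (S⊆H i∈S) (S⊆H 3∈S))
                                 (pendant-edge tree (S⊆H j∈S) (S⊆H 3∈S)) _ _ eq
    ...     | inj₁ (_ , refl) = refl

    Blocks : Fin (4 + m) → Fin (suc m) → Set
    Blocks w i = ∀ H → IsTree H → IsRainbow χ H → lobby i ∈ vertices H → 3F ∈ vertices H →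
                 ¬ (Edge H 0F w × Edge H w 3F)

    -- Either the two edges at `w` add two colours to the `m` pendant ones, or a coincidence of
    -- colours blocks the path 0 - `w` - 3.
    many-colors-or-blocked : (w : Fin (4 + m)) → (∀ j → pendant j ≢ w) → 0F ≢ w →
                             Adj graph 0F w → Adj graph w 3F →
                             2 + m ≤ c ⊎ ∃[ i ] Blocks w i
    many-colors-or-blocked w pendant≢w 0≢w p q with color χ 0F w p ≟ color χ w 3F q
    -- The path itself repeats a colour, so it lies in no rainbow tree; the lobby vertex 0 is an
    -- arbitrary choice.
    ... | yes α≡β = inj₂ (zero , λ H _ H-rainbow _ _ (e , f) →
      [ 0≢w ∘ proj₁ , (λ { (() , _) }) ]′ (same-color⇒same-edge χ H H-rainbow e f p q α≡β))
    ... | no α≢β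
      with any? (λ j → (pendant-color j ≟ color χ 0F w p) ⊎-dec (pendant-color j ≟ color χ w 3F q))
    -- Every tree through `pendant j` and 3 contains the pendant edge, whose colour the path
    -- repeats.
    ...   | yes (j , inj₁ κ≡α) = inj₂ (suc j , λ H tree H-rainbow j∈H 3∈H (e , f) →
      [ pendant≢w j ∘ proj₂ , 0≢w ∘ proj₁ ]′
        (same-color⇒same-edge χ H H-rainbow (pendant-edge tree j∈H 3∈H) e _ p κ≡α))
    ...   | yes (j , inj₂ κ≡β) = inj₂ (suc j , λ H tree H-rainbow j∈H 3∈H (e , f) →
      [ 0≢w ∘ proj₁ , (λ { (() , _) }) ]′
        (same-color⇒same-edge χ H H-rainbow (pendant-edge tree j∈H 3∈H) f _ q κ≡β))
    ...   | no ¬κ = inj₁ (injective⇒≤ {f = palette} (palette-injective _ _))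
      where
      palette : Fin (2 + m) → Fin c
      palette 0F            = color χ 0F w p
      palette 1F            = color χ w 3F q
      palette (suc (suc j)) = pendant-color j
      palette-injective : ∀ i j → palette i ≡ palette j → i ≡ j
      palette-injective 0F            0F            _  = refl
      palette-injective 0F            1F            eq = contradiction eq α≢β
      palette-injective 0F            (suc (suc j)) eq = contradiction (j , inj₁ (sym eq)) ¬κ
      palette-injective 1F            0F            eq = contradiction (sym eq) α≢β
      palette-injective 1F            1F            _  = refl
      palette-injective 1F            (suc (suc j)) eq = contradiction (j , inj₂ (sym eq)) ¬κ
      palette-injective (suc (suc i)) 0F            eq = contradiction (i , inj₁ eq) ¬κ
      palette-injective (suc (suc i)) 1F            eq = contradiction (i , inj₂ eq) ¬κ
      palette-injective (suc (suc i)) (suc (suc j)) eq =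
        cong (λ l → suc (suc l)) (pendant-color-injective i j eq)

    2+m≤colors : 2 + m ≤ c
    2+m≤colors with many-colors-or-blocked 1F (λ _ ()) (λ ()) _ _
                  | many-colors-or-blocked 2F (λ _ ()) (λ ()) _ _
    ... | inj₁ 2+m≤c      | _               = 2+m≤c
    ... | inj₂ _          | inj₁ 2+m≤c      = 2+m≤c
    -- One set `S` contains a blocking vertex for each path, together with 3.
    ... | inj₂ (i , ¬via-1) | inj₂ (j , ¬via-2)
      with three-element-superset (s≤s (s≤s (s≤s z≤n))) (lobby i) (lobby j) 3F
    ...   | S , ∣S∣≡3 , i∈S , j∈S , 3∈S with rainbow S ∣S∣≡3
    ...     | H , tree , H-rainbow , S⊆H with crosses-square tree {i} (S⊆H i∈S) (S⊆H 3∈S)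
    ...       | inj₁ via-1 = contradiction via-1 (¬via-1 H tree H-rainbow (S⊆H i∈S) (S⊆H 3∈S))
    ...       | inj₂ via-2 = contradiction via-2 (¬via-2 H tree H-rainbow (S⊆H j∈S) (S⊆H 3∈S))

-- The two values of t.

connected∧rx≤n-2⇒n≤size : 3 ≤ n → (G : Graph n) → Connected G → rx[ 3 ] G ≤ (n ∸ 2) → n ≤ size G
connected∧rx≤n-2⇒n≤size {suc (suc n)} 3≤n@(s≤s (s≤s _)) G conn (r , ((χ , rainbow) , _) , r≤n)
  with ℕ.≤-<-connex (suc (suc n)) (size G)
... | inj₁ n≤size = n≤size
... | inj₂ size<n =
  -- The order is written `suc (suc n)` here, so at most `n` colours are available while `suc n` are
  -- required.
  contradiction (ℕ.≤-trans (size<n⇒n≤1+colors 3≤n conn size<n χ rainbow) (s≤s r≤n)) ℕ.1+n≰n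

proposition2p13 : (n : ℕ) → 4 ≤ n → (t[ n , 3 , n ∸ 2 ]≡ n) × (t[ n , 3 , n ∸ 1 ]≡ (n ∸ 1))
proposition2p13 n@(suc k@(suc (suc (suc m)))) (s≤s (s≤s (s≤s (s≤s z≤n)))) =
  ( (PS.graph , PS.connected , PS-rx ,
      ℕ.≤-antisym PS.size≤ (connected∧rx≤n-2⇒n≤size 3≤n PS.graph PS.connected PS-rx))
  , λ { _ (G , conn , rx≤ , refl) → connected∧rx≤n-2⇒n≤size 3≤n G conn rx≤ } )
  ,
  ( (SG.graph , SG.connected , SG-rx ,
      ℕ.≤-antisym SG.size≤ (ℕ.≤-pred (connected⇒n≤1+size SG.graph SG.connected)))
  , λ { _ (G , conn , _ , refl) → ℕ.≤-pred (connected⇒n≤1+size G conn) } )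
  where
  module PS = PendantSquare m
  module SG = StarGraph k
  3≤n : 3 ≤ n
  3≤n = s≤s (s≤s (s≤s z≤n))
  -- The relation `rx[_]_≤_` asks for the exact index, so each colouring is accompanied by a proof
  -- that fewer colours do not suffice.
  PS-rx : rx[ 3 ] PS.graph ≤ (n ∸ 2)
  PS-rx = 2 + m , ((PS.coloring , PS.isRainbowColoring)
                  , λ { _ (χ , rainbow) → PS.2+m≤colors χ rainbow }) , ℕ.≤-refl
  SG-rx : rx[ 3 ] SG.graph ≤ k
  SG-rx = k , ((SG.coloring , SG.isRainbowColoring)
              , λ { _ (χ , rainbow) → ℕ.≤-pred (size<n⇒n≤1+colors 3≤n SG.connected (s≤s SG.size≤) χ rainbow) })
            , ℕ.≤-refl
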